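{- For every integer $k\geq 2$, every universal graph for $\mathcal{P}_k$ has line-width at least $k+1$, where $\mathcal{P}_k$ is the class of graphs with path-width at most $k$.
   Context: All graphs (including universal graphs) are simple and countable (the vertex set is finite or countably infinite). A graph $U$ contains a graph $G$ if a subgraph (not necessarily induced) of $U$ is isomorphic to $G$. A graph $U$ is universal for a graph class $\mathcal{G}$ if $U$ contains every graph in $\mathcal{G}$ ($U$ need not be in $\mathcal{G}$). A line-decomposition of a graph $G$ is a pair $((L,\preccurlyeq),(B_t:t\in L))$ where $L$ is a non-empty set, $\preccurlyeq$ is a total order of $L$, and the bags $B_t\subseteq V(G)$ satisfy: $\bigcup_{t\in L}B_t=V(G)$; for each $vw\in E(G)$ there is $t\in L$ with $v,w\in B_t$; and $B_{t_1}\cap B_{t_3}\subseteq B_{t_2}$ for all $t_1\preccurlyeq t_2\preccurlyeq t_3$ in $L$. Its width is $\sup_{t\in L}(|B_t|-1)$. The line-width of $G$ is the minimum width of a line-decomposition of $G$. A path-decomposition is a line-decomposition with $(L,\preccurlyeq)=(\mathbb{N},\leq)$, and the path-width of $G$ is the minimum width of a path-decomposition of $G$. Widths may be $\infty$. -}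

module Defs where

open import Level using (Level; 0ℓ; _⊔_) renaming (suc to lsuc)
open import Data.Fin.Base using (Fin)
open import Data.Integer.Base as ℤ using (ℤ; +_; _⊖_)
open import Data.List.Base using (List; length)
open import Data.List.Membership.Propositional using () renaming (_∈_ to _∈ₗ_)
open import Data.List.Relation.Unary.Unique.Propositional using (Unique)
open import Data.Maybe.Base as Maybe using ()
open import Data.Nat.Base as ℕ using (ℕ)
open import Data.Product.Base using (Σ; ∃; ∃-syntax; _×_)
open import Data.Sum.Base using (_⊎_)
open import Function.Bundles using (_⇔_; _↔_)
open import Function.Definitions using (Injective)
open import Relation.Binary.Core using (Rel)
open import Relation.Binary.Definitions using (Symmetric)
open import Relation.Binary.PropositionalEquality.Core using (_≡_)
open import Relation.Binary.Structures using (IsTotalOrder)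
open import Relation.Nullary.Construct.Add.Supremum using (_⁺; ⊤⁺; [_])
open import Relation.Nullary.Negation.Core using (¬_)
open import Relation.Unary using (Pred; _∈_; _⊆_; _∩_)

open import Relation.Binary.Construct.Add.Supremum.NonStrict ℤ._≤_ public
  using (_≤⁺_)

record Graph : Set₁ where
  field
    V           : Set
    E           : Rel V 0ℓ
    symmetric   : Symmetric E
    irreflexive : ∀ {v} → ¬ E v v
    countable   : (∃[ n ] (V ↔ Fin n)) ⊎ (V ↔ ℕ)

open Graph public using (V; E)

record Subgraph (U : Graph) : Set₁ where
  field
    Vertex     : Pred (V U) 0ℓ
    Edge       : Rel (V U) 0ℓ
    symmetric  : Symmetric Edge
    edge⇒E     : ∀ {u v} → Edge u v → E U u v
    edge-start : ∀ {u v} → Edge u v → u ∈ Vertex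

-- The bijection onto the vertices of H is a map into V U with image Vertex H:
-- the type Σ (V U) (Vertex H) could contain one vertex of U several times.
record IsIsomorphicTo (G : Graph) {U : Graph} (H : Subgraph U) : Set where
  open Subgraph H
  field
    to        : V G → V U
    injective : Injective _≡_ _≡_ to
    image     : ∀ u → (u ∈ Vertex) ⇔ (∃[ v ] to v ≡ u)
    edges     : ∀ v w → E G v w ⇔ Edge (to v) (to w)

_Contains_ : Graph → Graph → Set₁
U Contains G = Σ (Subgraph U) (IsIsomorphicTo G)

Universal : ∀ {p} → Graph → Pred Graph p → Set (lsuc 0ℓ ⊔ p)
Universal U 𝒢 = ∀ G → G ∈ 𝒢 → U Contains G

-- A list of the distinct elements, rather than a bijection Fin n ↔ Σ A P, so
-- that different proofs of membership of one element are not counted.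
HasCardinality : ∀ {a p} {A : Set a} → Pred A p → ℕ ⁺ → Set (a ⊔ p)
HasCardinality {A = A} P [ n ] =
  ∃[ xs ] (length {A = A} xs ≡ n × Unique xs × (∀ x → (x ∈ P) ⇔ (x ∈ₗ xs)))
HasCardinality P ⊤⁺ = ∀ n → ¬ HasCardinality P [ n ]

-- Widths may be infinite, and are −1 for a graph without vertices.
Width : Set
Width = ℤ ⁺

_minusOne : ℕ ⁺ → Width
c minusOne = Maybe.map (_⊖ 1) c

IsUpperBound : ∀ {p} → Pred Width p → Pred Width p
IsUpperBound P u = ∀ x → x ∈ P → x ≤⁺ u

IsSupremum : ∀ {p} → Pred Width p → Pred Width p
IsSupremum P s = IsUpperBound P s × (∀ u → IsUpperBound P u → s ≤⁺ u)

IsMinimum : ∀ {p} → Pred Width p → Pred Width p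
IsMinimum P m = m ∈ P × (∀ x → x ∈ P → m ≤⁺ x)

record DecompositionOver {ℓ} (G : Graph) {L : Set ℓ} (_≼_ : Rel L ℓ)
       : Set (lsuc ℓ) where
  field
    Bag            : L → Pred (V G) ℓ
    coversVertices : ∀ v → ∃[ t ] v ∈ Bag t
    coversEdges    : ∀ v w → E G v w → ∃[ t ] (v ∈ Bag t × w ∈ Bag t)
    interval       : ∀ t₁ t₂ t₃ → t₁ ≼ t₂ → t₂ ≼ t₃ →
                     (Bag t₁ ∩ Bag t₃) ⊆ Bag t₂

IsWidth : ∀ {ℓ} {G : Graph} {L : Set ℓ} {_≼_ : Rel L ℓ} →
          DecompositionOver G _≼_ → Pred Width ℓ
IsWidth D = IsSupremum λ x →
  ∃[ t ] ∃[ c ] (HasCardinality (Bag t) c × x ≡ c minusOne)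
  where open DecompositionOver D

record LineDecomposition (ℓ : Level) (G : Graph) : Set (lsuc ℓ) where
  field
    L             : Set ℓ
    nonEmpty      : L
    _≼_           : Rel L ℓ
    isTotalOrder  : IsTotalOrder _≡_ _≼_
    decomposition : DecompositionOver G _≼_

PathDecomposition : Graph → Set₁
PathDecomposition G = DecompositionOver G ℕ._≤_

IsLineWidth : (ℓ : Level) → Graph → Pred Width (lsuc ℓ)
IsLineWidth ℓ G = IsMinimum λ w →
  Σ (LineDecomposition ℓ G) λ D → IsWidth (LineDecomposition.decomposition D) w

IsPathWidth : Graph → Pred Width (lsuc 0ℓ)
IsPathWidth G = IsMinimum λ w → Σ (PathDecomposition G) λ D → IsWidth D w

LineWidthAtLeast : (ℓ : Level) → Graph → ℕ → Set (lsuc ℓ)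
LineWidthAtLeast ℓ G k = ∃[ w ] (IsLineWidth ℓ G w × [ + k ] ≤⁺ w)

PathWidthAtMost : Graph → ℕ → Set₁
PathWidthAtMost G k = ∃[ w ] (IsPathWidth G w × w ≤⁺ [ + k ])

𝒫 : ℕ → Pred Graph (lsuc 0ℓ)
𝒫 k G = PathWidthAtMost G k

{-# OPTIONS --safe #-}

-- Every binary sequence α is encoded in a graph G α on ℕ that is covered by
-- the (k+1)-cliques {p n} ∪ {n+1, …, n+k}, where the next clique receives the
-- vertex n+k+1 and loses either n+1 or p n, according to α n.  These cliques
-- form a path-decomposition of width k.  Suppose U contains all G α and has a
-- line-decomposition with at most k+1 vertices in every bag.  By the Helly
-- property every clique of G α is then exactly a bag, and the bags of
-- consecutive cliques are monotone along the line.  The images of the vertices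
-- 0, …, k and the direction in which the bags move determine the rest: of two
-- different continuations, the one whose next bag is nearer would have to
-- pass the other one, which its small bags do not permit.  Thus α ↦ (images of
-- 0, …, k; direction) injects the uncountable set of binary sequences into a
-- countable set.
module Submission where

open import Defs
open import Axiom.ExcludedMiddle using (ExcludedMiddle)
open import Data.Bool.Base using (Bool; true; false; not; if_then_else_)
open import Data.Fin.Base using (Fin; zero; suc; toℕ; fromℕ<)
open import Data.Fin.Properties using (toℕ-fromℕ<; toℕ-injective; toℕ<n; injective⇒≤)
open import Data.Integer.Base as ℤ using (+_; -[1+_]; _⊖_)
import Data.Integer.Properties as ℤ
open import Data.List.Base using (List; length; lookup; tabulate)
open import Data.List.Membership.Propositional using () renaming (_∈_ to _∈ₗ_)
open import Data.List.Membership.Propositional.Properties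
  using (∈-lookup; ∈-tabulate⁺; ∈-tabulate⁻)
open import Data.List.Membership.Setoid.Properties using (index-injective)
open import Data.List.Properties using (length-tabulate)
open import Data.List.Relation.Unary.Any using (index)
open import Data.List.Relation.Unary.AllPairs using (_∷_)
open import Data.List.Relation.Unary.Unique.Propositional using (Unique)
open import Data.List.Relation.Unary.Unique.Propositional.Properties
  using (tabulate⁺; Unique[x∷xs]⇒x∉xs)
open import Data.Nat.Base
open import Data.Nat.Induction using (<-rec)
open import Data.Nat.Properties
open import Data.Product.Base using (Σ; ∃; ∃-syntax; _×_; _,_; proj₁; proj₂)
open import Data.Sum.Base using (_⊎_; inj₁; inj₂)
open import Data.Unit.Polymorphic.Base using (⊤; tt)
open import Function.Base using (_∘_; flip)
open import Function.Bundles using (mk⇔; module Equivalence; module Injection; module Inverse)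
open import Function.Construct.Identity using (↔-id)
open import Function.Definitions using (Injective)
open import Function.Properties.Inverse using (↔⇒↣)
open import Level using (Level; 0ℓ)
open import Relation.Binary.Construct.Add.Supremum.NonStrict ℤ._≤_ using ([_]; _≤⊤⁺; ≤⁺-trans)
open import Relation.Binary.Core using (Rel)
open import Relation.Binary.Definitions using (Total)
open import Relation.Binary.PropositionalEquality
open import Relation.Binary.Structures using (IsTotalOrder)
open import Relation.Nullary.Construct.Add.Supremum using (⊤⁺; [_])
open import Relation.Nullary.Decidable.Core using (Dec; does; yes; no)
open import Relation.Nullary.Negation.Core using (¬_; contradiction)
open import Relation.Unary using (Pred; _∈_; _∉_)

private
  variable
    a ℓ : Level

-- Cardinalities and widths

least : ExcludedMiddle ℓ → {P : Pred ℕ ℓ} → ∀ n → n ∈ P →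
        ∃[ m ] (m ∈ P × (∀ i → i ∈ P → m ≤ i))
least em {P} = <-rec _ λ n rec n∈P → step n rec n∈P em
  where
  step : ∀ n → (∀ {i} → i < n → i ∈ P → ∃[ m ] (m ∈ P × (∀ i → i ∈ P → m ≤ i))) →
         n ∈ P → Dec (∃[ i ] (i < n × i ∈ P)) →
         ∃[ m ] (m ∈ P × (∀ i → i ∈ P → m ≤ i))
  step n rec n∈P (yes (i , i<n , i∈P)) = rec i<n i∈P
  step n rec n∈P (no none)             =
    n , n∈P , λ i i∈P → ≮⇒≥ λ i<n → none (i , i<n , i∈P)

-- The integers are not well-founded, but from -1 upwards widths are shifted cardinalities, so
-- minima can be sought in `ℕ`.
≥-1⇒minusOne : ∀ {w} → [ -[1+ 0 ] ] ≤⁺ w → ∃[ c ] w ≡ c minusOne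
≥-1⇒minusOne {[ + n ]}          _               = [ suc n ] , refl
≥-1⇒minusOne {[ -[1+ zero ] ]}  _               = [ zero ] , refl
≥-1⇒minusOne {[ -[1+ suc n ] ]} [ ℤ.-≤- () ]
≥-1⇒minusOne {⊤⁺}               _               = ⊤⁺ , refl

minusOne≥-1 : ∀ c → [ -[1+ 0 ] ] ≤⁺ c minusOne
minusOne≥-1 [ n ] = [ ℤ.⊖-monoˡ-≤ 1 {0} {n} z≤n ]
minusOne≥-1 ⊤⁺    = _ ≤⊤⁺

hasMinimum : ExcludedMiddle ℓ → {P : Pred Width ℓ} →
             (∀ w → w ∈ P → [ -[1+ 0 ] ] ≤⁺ w) → ∃ P → ∃ (IsMinimum P)
hasMinimum em {P} bounded (w , w∈P) with em {∃[ n ] [ n ⊖ 1 ] ∈ P}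
... | yes (n , n∈P) with m , m∈P , minimal ← least em n n∈P =
  [ m ⊖ 1 ] , m∈P , below
  where
  below : ∀ x → x ∈ P → [ m ⊖ 1 ] ≤⁺ x
  below x x∈P with ≥-1⇒minusOne (bounded x x∈P)
  ... | [ i ] , refl = [ ℤ.⊖-monoˡ-≤ 1 (minimal i x∈P) ]
  ... | ⊤⁺    , refl = _ ≤⊤⁺
... | no infinite =
  ⊤⁺ , subst P (only-⊤ w w∈P) w∈P , λ x x∈P → subst (⊤⁺ ≤⁺_) (sym (only-⊤ x x∈P)) (⊤⁺ ≤⊤⁺)
  where
  only-⊤ : ∀ x → x ∈ P → x ≡ ⊤⁺
  only-⊤ x x∈P with ≥-1⇒minusOne (bounded x x∈P)
  ... | [ i ] , refl = contradiction (i , x∈P) infinite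
  ... | ⊤⁺    , refl = refl

hasCardinality : {A : Set} → ExcludedMiddle ℓ → (P : Pred A ℓ) → ∃ (HasCardinality P)
hasCardinality em P with em {∃[ n ] HasCardinality P [ n ]}
... | yes (n , P-n) = [ n ] , P-n
... | no infinite   = ⊤⁺ , λ n P-n → infinite (n , P-n)

injection⇒≤ : {A : Set a} {P : Pred A ℓ} {m n : ℕ} → HasCardinality P [ n ] →
              (f : Fin m → A) → Injective _≡_ _≡_ f → (∀ i → f i ∈ P) → m ≤ n
injection⇒≤ {A = A} (xs , refl , _ , P⇔xs) f f-injective f∈P =
  injective⇒≤ {f = λ i → index (f∈xs i)}
    (λ {i} {j} eq → f-injective (index-injective (setoid A) (f∈xs i) (f∈xs j) eq))
  where f∈xs = λ i → Equivalence.to (P⇔xs (f i)) (f∈P i)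

lookup-injective : {A : Set a} {xs : List A} → Unique xs → Injective _≡_ _≡_ (lookup xs)
lookup-injective (_ ∷ _)         {zero}  {zero}  eq = refl
lookup-injective (_ ∷ unique)    {suc i} {suc j} eq = cong suc (lookup-injective unique eq)
lookup-injective unique@(_ ∷ _)  {zero}  {suc j} eq =
  contradiction (subst (_∈ₗ _) (sym eq) (∈-lookup j)) (Unique[x∷xs]⇒x∉xs unique)
lookup-injective unique@(_ ∷ _)  {suc i} {zero}  eq =
  contradiction (subst (_∈ₗ _) eq (∈-lookup i)) (Unique[x∷xs]⇒x∉xs unique)

module _ {G : Graph} {L : Set ℓ} {_≼_ : Rel L ℓ} (em : ExcludedMiddle ℓ) (t₀ : L)
         (D : DecompositionOver G _≼_) where
  open DecompositionOver D

  IsWidth⇒≥-1 : ∀ w → IsWidth D w → [ -[1+ 0 ] ] ≤⁺ w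
  IsWidth⇒≥-1 w (upper , _) with c , Bag-c ← hasCardinality em (Bag t₀) =
    ≤⁺-trans ℤ.≤-trans (minusOne≥-1 c) (upper _ (t₀ , c , Bag-c , refl))

  -- A supremum is a minimum of upper bounds, and `⊤⁺` is always one of these.
  hasWidth : ∃ (IsWidth D)
  hasWidth with c , Bag-c ← hasCardinality em (Bag t₀) =
    hasMinimum em
      (λ u upper → ≤⁺-trans ℤ.≤-trans (minusOne≥-1 c) (upper _ (t₀ , c , Bag-c , refl)))
      (⊤⁺ , λ x _ → x ≤⊤⁺)

-- Serves to inhabit the set of widths whose minimum is the line-width.
trivialDecomposition : (ℓ : Level) (G : Graph) → LineDecomposition ℓ G
trivialDecomposition ℓ G = record
  { L             = ⊤
  ; nonEmpty      = tt
  ; _≼_           = λ _ _ → ⊤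
  ; isTotalOrder  = record
    { isPartialOrder = record
      { isPreorder = record
        { isEquivalence = isEquivalence
        ; reflexive     = λ _ → tt
        ; trans         = λ _ _ → tt
        }
      ; antisym    = λ _ _ → refl
      }
    ; total          = λ _ _ → inj₁ tt
    }
  ; decomposition = record
    { Bag            = λ _ _ → ⊤
    ; coversVertices = λ _ → tt , tt
    ; coversEdges    = λ _ _ _ → tt , tt , tt
    ; interval       = λ _ _ _ _ _ _ → tt
    }
  }

hasLineWidth : (∀ {ℓ} → ExcludedMiddle ℓ) → (ℓ : Level) (G : Graph) → ∃ (IsLineWidth ℓ G)
hasLineWidth em ℓ G =
  hasMinimum em
    (λ w (D , D-w) → IsWidth⇒≥-1 em (LineDecomposition.nonEmpty D)
                                   (LineDecomposition.decomposition D) w D-w)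
    (proj₁ trivial-w , trivial , proj₂ trivial-w)
  where
  trivial   = trivialDecomposition ℓ G
  trivial-w = hasWidth em tt (LineDecomposition.decomposition trivial)

-- Injections into ℕ and diagonalisation

-- This is 2^m (2n + 1), so parity separates the cases.
pair : ℕ → ℕ → ℕ
pair zero    n = suc (2 * n)
pair (suc m) n = 2 * pair m n

pair-injective : ∀ m n m′ n′ → pair m n ≡ pair m′ n′ → m ≡ m′ × n ≡ n′
pair-injective zero    n zero     n′ eq = refl , *-cancelˡ-≡ n n′ 2 (suc-injective eq)
pair-injective zero    n (suc m′) n′ eq = contradiction (sym eq) (even≢odd (pair m′ n′) n)
pair-injective (suc m) n zero     n′ eq = contradiction eq (even≢odd (pair m n) n′)
pair-injective (suc m) n (suc m′) n′ eq
  with refl , n≡n′ ← pair-injective m n m′ n′ (*-cancelˡ-≡ (pair m n) (pair m′ n′) 2 eq) =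
  refl , n≡n′

-- The length `n` is not part of the code; only codes of equal length are compared.
encode : (ℕ → ℕ) → ℕ → ℕ
encode f zero    = zero
encode f (suc n) = pair (f n) (encode f n)

encode-injective : ∀ f g n → encode f n ≡ encode g n → ∀ {i} → i < n → f i ≡ g i
encode-injective f g (suc n) eq i<1+n
  with pair-injective (f n) (encode f n) (g n) (encode g n) eq | m<1+n⇒m<n∨m≡n i<1+n
... | _   , eq′ | inj₁ i<n  = encode-injective f g n eq′ i<n
... | f≡g , _   | inj₂ refl = f≡g

-- The diagonal sequence is false at `m` exactly if some sequence with code `m` is true there. With
-- a relation `R`, a sequence may have several codes and none has to be chosen.
cantor : ExcludedMiddle ℓ → (R : (ℕ → Bool) → ℕ → Set ℓ) →
         (∀ {α β m} → R α m → R β m → α ≗ β) → ∃[ α ] (∀ m → ¬ R α m)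
cantor em R injective = α , avoids
  where
  diagonal? : ∀ m → Dec (∃[ β ] (R β m × β m ≡ true))
  diagonal? m = em

  α : ℕ → Bool
  α m = not (does (diagonal? m))

  avoids : ∀ m → ¬ R α m
  avoids m Rα with diagonal? m in eq
  ... | yes (β , Rβ , βm) =
    contradiction (trans (sym βm) (trans (injective Rβ Rα m) (cong (not ∘ does) eq))) λ ()
  -- Here `α m` is true, so `α` itself is the sequence that `none` excludes.
  ... | no none = none (α , Rα , cong (not ∘ does) eq)

countable⇒injection : (G : Graph) → Σ (V G → ℕ) (Injective _≡_ _≡_)
countable⇒injection G with Graph.countable G
... | inj₁ (n , V↔Fin) = toℕ ∘ Inverse.to V↔Fin , Injection.injective (↔⇒↣ V↔Fin) ∘ toℕ-injective
... | inj₂ V↔ℕ         = Inverse.to V↔ℕ , Injection.injective (↔⇒↣ V↔ℕ)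

-- The graphs of binary sequences

pivot : (ℕ → Bool) → ℕ → ℕ
pivot α zero    = zero
pivot α (suc n) = if α n then pivot α n else suc n

pivot≤ : ∀ α n → pivot α n ≤ n
pivot≤ α zero    = z≤n
pivot≤ α (suc n) with α n
... | true  = m≤n⇒m≤1+n (pivot≤ α n)
... | false = ≤-refl

-- Every change after `m` makes the pivot larger than `m`, so a pivot that is still at most `m` has
-- not changed since.
pivot-stable : ∀ α {m n} → m ≤′ n → pivot α n ≤ m → pivot α m ≡ pivot α n
pivot-stable α ≤′-refl         _ = refl
pivot-stable α (≤′-step {n} m≤n) p with α n
... | true  = pivot-stable α m≤n p
... | false = contradiction p (<⇒≱ (s≤s (≤′⇒≤ m≤n)))

dropped : (ℕ → Bool) → ℕ → ℕ
dropped α n = if α n then suc n else pivot α n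

module Cliques (k : ℕ) (2≤k : 2 ≤ k) where

  Clique : (ℕ → Bool) → ℕ → Pred ℕ 0ℓ
  Clique α n v = v ≡ pivot α n ⊎ (n < v × v ≤ n + k)

  ∈Clique⇒≤ : ∀ α {n v} → v ∈ Clique α n → v ≤ n + k
  ∈Clique⇒≤ α {n} (inj₁ refl)    = ≤-trans (pivot≤ α n) (m≤m+n n k)
  ∈Clique⇒≤ α     (inj₂ (_ , p)) = p

  private
    2+n≤n+k : ∀ n → suc (suc n) ≤ n + k
    2+n≤n+k n = subst (_≤ n + k) (+-comm n 2) (+-monoʳ-≤ n 2≤k)

    1+n≤n+k : ∀ n → suc n ≤ n + k
    1+n≤n+k n = <⇒≤ (2+n≤n+k n)

  newest∈Clique : ∀ α n → n + k ∈ Clique α n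
  newest∈Clique α n = inj₂ (1+n≤n+k n , ≤-refl)

  newest∈nextClique : ∀ α n → n + k ∈ Clique α (suc n)
  newest∈nextClique α n = inj₂ (2+n≤n+k n , n≤1+n (n + k))

  dropped∈Clique : ∀ α n → dropped α n ∈ Clique α n
  dropped∈Clique α n with α n
  ... | true  = inj₂ (≤-refl , 1+n≤n+k n)
  ... | false = inj₁ refl

  -- Only the newest vertex of the clique of `suc n` is missing from that of `n`, and it is not
  -- dropped at once because `k` is at least 2.
  dropped∈previousClique : ∀ α n → dropped α (suc n) ∈ Clique α n
  dropped∈previousClique α n with α (suc n) | α n
  ... | true  | _     = inj₂ (n≤1+n (suc n) , 2+n≤n+k n)
  ... | false | true  = inj₁ refl
  ... | false | false = inj₂ (≤-refl , 1+n≤n+k n)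

  dropped∉nextClique : ∀ α n → dropped α n ∉ Clique α (suc n)
  dropped∉nextClique α n d∈ with α n
  dropped∉nextClique α n (inj₁ eq)      | true  = <⇒≢ (s≤s (pivot≤ α n)) (sym eq)
  dropped∉nextClique α n (inj₂ (p , _)) | true  = <-irrefl refl p
  dropped∉nextClique α n (inj₁ eq)      | false = <⇒≢ (s≤s (pivot≤ α n)) eq
  dropped∉nextClique α n (inj₂ (p , _)) | false = <⇒≱ p (m≤n⇒m≤1+n (pivot≤ α n))

  -- The candidates are `suc n` and the common pivot. Whoever drops one keeps the other as the next
  -- pivot, so opposite choices keep what the other drops.
  dropped∈otherClique : ∀ α β n → pivot α n ≡ pivot β n →
                        α n ≡ β n ⊎ dropped α n ∈ Clique β (suc n)
  dropped∈otherClique α β n eq with α n | β n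
  ... | true  | true  = inj₁ refl
  ... | false | false = inj₁ refl
  ... | true  | false = inj₂ (inj₁ refl)
  ... | false | true  = inj₂ (inj₁ eq)

  pivot-suc-cong : ∀ α β n → pivot α n ≡ pivot β n → α n ≡ β n → pivot α (suc n) ≡ pivot β (suc n)
  pivot-suc-cong α β n eq αn≡βn rewrite eq | αn≡βn = refl

  -- A vertex above `b` is recent enough for the clique of `b`. One that is at most `b` survives
  -- until `c` only as the pivot, and by `pivot-stable` it is the pivot at `b` already.
  Clique-interval : ∀ α {a b c v} → a ≤ b → b ≤ c →
                    v ∈ Clique α a → v ∈ Clique α c → v ∈ Clique α b
  Clique-interval α {a} {b} {c} {v} a≤b b≤c va vc with v ≤? b
  ... | no v≰b  = inj₂ (≰⇒> v≰b , ≤-trans (∈Clique⇒≤ α va) (+-monoˡ-≤ k a≤b))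
  ... | yes v≤b with vc
  ...   | inj₁ refl      = inj₁ (sym (pivot-stable α (≤⇒≤′ b≤c) v≤b))
  ...   | inj₂ (c<v , _) = contradiction (≤-trans v≤b b≤c) (<⇒≱ c<v)

  member : (ℕ → Bool) → ℕ → Fin (suc k) → ℕ
  member α n zero    = pivot α n
  member α n (suc i) = suc (n + toℕ i)

  member-injective : ∀ α n → Injective _≡_ _≡_ (member α n)
  member-injective α n {zero}  {zero}  eq = refl
  member-injective α n {zero}  {suc j} eq =
    contradiction eq (<⇒≢ (s≤s (≤-trans (pivot≤ α n) (m≤m+n n (toℕ j)))))
  member-injective α n {suc i} {zero}  eq =
    contradiction (sym eq) (<⇒≢ (s≤s (≤-trans (pivot≤ α n) (m≤m+n n (toℕ i)))))
  member-injective α n {suc i} {suc j} eq =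
    cong suc (toℕ-injective (+-cancelˡ-≡ n (toℕ i) (toℕ j) (suc-injective eq)))

  member∈Clique : ∀ α n i → member α n i ∈ Clique α n
  member∈Clique α n zero    = inj₁ refl
  member∈Clique α n (suc i) = inj₂ (s≤s (m≤m+n n (toℕ i)) , +-monoʳ-< n (toℕ<n i))

  ∈Clique⇒member : ∀ α n {v} → v ∈ Clique α n → ∃[ i ] v ≡ member α n i
  ∈Clique⇒member α n (inj₁ refl)        = zero , refl
  ∈Clique⇒member α n {v} (inj₂ (n<v , v≤n+k)) with i , refl ← m≤n⇒∃[o]m+o≡n n<v =
    suc (fromℕ< i<k) , cong (λ i → suc (n + i)) (sym (toℕ-fromℕ< i<k))
    where
    i<k = +-cancelˡ-< n _ k v≤n+k

  graph : (ℕ → Bool) → Graph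
  graph α = record
    { V           = ℕ
    ; E           = λ u v → u ≢ v × ∃[ n ] (u ∈ Clique α n × v ∈ Clique α n)
    ; symmetric   = λ (u≢v , n , u∈ , v∈) → u≢v ∘ sym , n , v∈ , u∈
    ; irreflexive = λ (v≢v , _) → v≢v refl
    ; countable   = inj₂ (↔-id ℕ)
    }

  pathDecomposition : ∀ α → PathDecomposition (graph α)
  pathDecomposition α = record
    { Bag            = Clique α
    ; coversVertices = covers
    ; coversEdges    = λ _ _ → proj₂
    ; interval       = λ _ _ _ a≤b b≤c (va , vc) → Clique-interval α a≤b b≤c va vc
    }
    where
    covers : ∀ v → ∃[ n ] v ∈ Clique α n
    covers zero    = zero , inj₁ refl
    covers (suc v) = v , inj₂ (≤-refl , 1+n≤n+k v)

  Clique-cardinality : ∀ α n → HasCardinality (Clique α n) [ suc k ]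
  Clique-cardinality α n =
    tabulate (member α n) , length-tabulate (member α n) , tabulate⁺ (member-injective α n) ,
    λ v → mk⇔
      (λ v∈ → let i , eq = ∈Clique⇒member α n v∈ in
             subst (_∈ₗ _) (sym eq) (∈-tabulate⁺ {f = member α n} i))
      (λ v∈ → let i , eq = ∈-tabulate⁻ {f = member α n} v∈ in
             subst (Clique α n) (sym eq) (member∈Clique α n i))

  -- Membership in `𝒫` asks for the exact path-width, so its existence comes first; the
  -- decomposition into cliques then bounds it.
  graph∈𝒫 : ExcludedMiddle 0ℓ → ExcludedMiddle (Level.suc 0ℓ) → ∀ α → graph α ∈ 𝒫 k
  graph∈𝒫 em em₁ α = _ , proj₂ minimum , ≤⁺-trans ℤ.≤-trans
    (proj₂ (proj₂ minimum) _ (pathDecomposition α , proj₂ width))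
    (proj₂ (proj₂ width) _ bounded)
    where
    width   = hasWidth em 0 (pathDecomposition α)
    minimum = hasMinimum em₁ (λ w (D , D-w) → IsWidth⇒≥-1 em 0 D w D-w)
                (_ , pathDecomposition α , proj₂ width)

    bounded : IsUpperBound
                (λ x → ∃[ n ] ∃[ c ] (HasCardinality (Clique α n) c × x ≡ c minusOne)) [ + k ]
    bounded _ (n , [ c ] , (xs , refl , unique , Clique⇔xs) , refl) =
      [ ℤ.⊖-monoˡ-≤ 1 {length xs} {suc k} (injection⇒≤ (Clique-cardinality α n)
        (lookup xs) (lookup-injective unique)
        (λ i → Equivalence.from (Clique⇔xs (lookup xs i)) (∈-lookup i))) ]
    bounded _ (n , ⊤⁺ , infinite , refl) =
      contradiction (Clique-cardinality α n) (infinite (suc k))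

-- Convex sets on a line

Convex : {L : Set ℓ} → Rel L ℓ → Pred L ℓ → Set ℓ
Convex _≼_ P = ∀ {x y z} → x ≼ y → y ≼ z → x ∈ P → z ∈ P → y ∈ P

module Helly {L : Set ℓ} (_≼_ : Rel L ℓ) (total : Total _≼_) where

  -- The middle one of three points lies between the other two. It is chosen before `P`, so one
  -- point serves all convex sets.
  median : ∀ x y z → ∃[ m ] (∀ {P} → Convex _≼_ P →
           (x ∈ P → y ∈ P → m ∈ P) × (x ∈ P → z ∈ P → m ∈ P) × (y ∈ P → z ∈ P → m ∈ P))
  median x y z with total x y | total y z | total x z
  ... | inj₁ x≼y | inj₁ y≼z | _        = y , λ C → (λ _ p → p) , C x≼y y≼z , (λ p _ → p)
  ... | inj₁ x≼y | inj₂ z≼y | inj₁ x≼z = z , λ C → C x≼z z≼y , (λ _ p → p) , (λ _ p → p)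
  ... | inj₁ x≼y | inj₂ z≼y | inj₂ z≼x = x , λ C → (λ p _ → p) , (λ p _ → p) , flip (C z≼x x≼y)
  ... | inj₂ y≼x | inj₁ y≼z | inj₁ x≼z = x , λ C → (λ p _ → p) , (λ p _ → p) , C y≼x x≼z
  ... | inj₂ y≼x | inj₁ y≼z | inj₂ z≼x = z , λ C → flip (C y≼z z≼x) , (λ _ p → p) , (λ _ p → p)
  ... | inj₂ y≼x | inj₂ z≼y | _        = y , λ C → (λ _ p → p) , flip (C z≼y y≼x) , (λ p _ → p)

  -- A median of x, a common point of the sets treated so far (and of Q), and a
  -- point of Q in the next set lies in all of them.
  meet-all : ∀ {n} (P : Fin n → Pred L ℓ) {Q} → (∀ i → Convex _≼_ (P i)) → Convex _≼_ Q →
             ∀ x → (∀ i → x ∈ P i) → ∃ Q → (∀ i → ∃[ q ] (q ∈ Q × q ∈ P i)) →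
             ∃[ y ] (y ∈ Q × (∀ i → y ∈ P i))
  meet-all {zero}  P convex convexQ x x∈P (q , q∈Q) meet = q , q∈Q , λ ()
  meet-all {suc n} P convex convexQ x x∈P q         meet
    with y , y∈Q , y∈P ← meet-all (P ∘ suc) (convex ∘ suc) convexQ x (x∈P ∘ suc) q (meet ∘ suc)
       | r , r∈Q , r∈P ← meet zero
    with m , m-median ← median x y r =
    m , proj₂ (proj₂ (m-median convexQ)) y∈Q r∈Q , λ where
      zero    → proj₁ (proj₂ (m-median (convex zero))) (x∈P zero) r∈P
      (suc i) → proj₁ (m-median (convex (suc i))) (x∈P (suc i)) (y∈P i)

  -- By induction the sets after the first have a common point, which `meet-all` moves into the
  -- first set, taken as `Q`.
  helly : L → ∀ {n} (P : Fin n → Pred L ℓ) → (∀ i → Convex _≼_ (P i)) →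
          (∀ i j → ∃[ x ] (x ∈ P i × x ∈ P j)) → ∃[ x ] (∀ i → x ∈ P i)
  helly x₀ {zero}  P convex meet = x₀ , λ ()
  helly x₀ {suc n} P convex meet
    with x , x∈P ← helly x₀ (P ∘ suc) (convex ∘ suc) (λ i j → meet (suc i) (suc j))
    with y , y∈P₀ , y∈P ← meet-all (P ∘ suc) (convex ∘ suc) (convex zero) x x∈P
                            -- The hypothesis includes equal indices and so makes the first set
                            -- inhabited.
                            (let q , q∈P₀ , _ = meet zero zero in q , q∈P₀)
                            (λ i → meet zero (suc i)) =
    y , λ where
      zero    → y∈P₀
      (suc i) → y∈P i

-- Copies of the graphs in a line-decomposition with small bags

module Copies (k : ℕ) (2≤k : 2 ≤ k) {A : Set} {L : Set ℓ} (Bag : L → Pred A ℓ) where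
  open Cliques k 2≤k

  -- The order of the line does not occur here, so the same copy can be read in both directions.
  record Copy (α : ℕ → Bool) : Set ℓ where
    field
      φ           : ℕ → A
      φ-injective : Injective _≡_ _≡_ φ
      time        : ℕ → L
      φ∈Bag       : ∀ n {v} → v ∈ Clique α n → φ v ∈ Bag (time n)
      ∈Bag⇒φ      : ∀ n {a} → a ∈ Bag (time n) → ∃[ v ] (v ∈ Clique α n × φ v ≡ a)

    φ∈Bag⁻ : ∀ n {v} → φ v ∈ Bag (time n) → v ∈ Clique α n
    φ∈Bag⁻ n φv∈ with u , u∈ , eq ← ∈Bag⇒φ n φv∈ = subst (Clique α n) (φ-injective eq) u∈

  Ascending : ∀ {α} → Rel L ℓ → Copy α → Set ℓ
  Ascending _≼_ C = ∀ n → time n ≼ time (suc n)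
    where open Copy C

  module Direction (_≼_ : Rel L ℓ) (total : Total _≼_)
                   (convex : ∀ a → Convex _≼_ (λ t → a ∈ Bag t)) where

    module _ {α : ℕ → Bool} (C : Copy α) where
      open Copy C

      -- The bags cannot turn back at `suc n`. A bag of `2 + n` between the two previous ones would
      -- contain the vertex dropped at `suc n`; if it came before both, the bag of `n` would contain
      -- a vertex that only enters at `suc n`.
      ascending : time 0 ≼ time 1 → Ascending _≼_ C
      ascending 0≼1 zero    = 0≼1
      ascending 0≼1 (suc n) with total (time (suc n)) (time (2 + n))
      ... | inj₁ up   = up
      ... | inj₂ down with total (time n) (time (2 + n))
      ...   | inj₁ n≼2+n = contradiction
        (φ∈Bag⁻ (2 + n) (convex _ n≼2+n down
          (φ∈Bag n (dropped∈previousClique α n)) (φ∈Bag (suc n) (dropped∈Clique α (suc n)))))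
        (dropped∉nextClique α (suc n))
      ...   | inj₂ 2+n≼n = contradiction
        (∈Clique⇒≤ α (φ∈Bag⁻ n (convex _ 2+n≼n (ascending 0≼1 n)
          (φ∈Bag (2 + n) (newest∈nextClique α (suc n)))
          (φ∈Bag (suc n) (newest∈Clique α (suc n))))))
        1+n≰n

    module _ {α β : ℕ → Bool} (C : Copy α) (C′ : Copy β) where
      open Copy C
      open Copy C′ using () renaming
        (φ to φ′; time to time′; φ∈Bag to φ′∈Bag; ∈Bag⇒φ to ∈Bag⇒φ′)

      Agree : ℕ → Set
      Agree n = pivot α n ≡ pivot β n × (∀ {v} → v ≤ n + k → φ v ≡ φ′ v)

      -- `C` is the copy whose next bag comes first. What it drops on the way to `time′ (suc n)`
      -- cannot be in the bag there.
      agree-step : Ascending _≼_ C → ∀ n → Agree n → time (suc n) ≼ time′ (suc n) →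
                   α n ≡ β n × φ (suc n + k) ≡ φ′ (suc n + k)
      agree-step asc n (pivots , φ≡φ′) up = αn≡βn , newest≡
        where
        ∈C′ : ∀ {v} → v ∈ Clique β (suc n) → v ≤ n + k → φ v ∈ Bag (time′ (suc n))
        ∈C′ v∈ v≤ = subst (_∈ Bag (time′ (suc n))) (sym (φ≡φ′ v≤)) (φ′∈Bag (suc n) v∈)

        αn≡βn : α n ≡ β n
        αn≡βn with dropped∈otherClique α β n pivots
        ... | inj₁ eq = eq
        -- A vertex dropped by `α` but kept by `β` is in the bags at `time n` and `time′ (suc n)`,
        -- hence in the one at `time (suc n)` between them, which has lost it.
        ... | inj₂ d∈ = contradiction
          (φ∈Bag⁻ (suc n) (convex _ (asc n) up
            (φ∈Bag n (dropped∈Clique α n)) (∈C′ d∈ (∈Clique⇒≤ α (dropped∈Clique α n)))))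
          (dropped∉nextClique α n)

        sameClique : ∀ {v} → v ∈ Clique α (suc n) → v ∈ Clique β (suc n)
        sameClique (inj₁ eq) = inj₁ (trans eq (pivot-suc-cong α β n pivots αn≡βn))
        sameClique (inj₂ p)  = inj₂ p

        newest≡ : φ (suc n + k) ≡ φ′ (suc n + k)
        newest≡ with total (time′ (suc n)) (time (2 + n))
        -- The newest vertex of `C` stays for two bags and so is in the bag of `C′` between them. By
        -- injectivity it is not the image of an older vertex, which leaves the newest one of `C′`.
        ... | inj₁ before
          with v , v∈ , eq ← ∈Bag⇒φ′ (suc n) (convex _ up before
                 (φ∈Bag (suc n) (newest∈Clique α (suc n)))
                 (φ∈Bag (2 + n) (newest∈nextClique α (suc n))))
          with m≤n⇒m<n∨m≡n (∈Clique⇒≤ β v∈)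
        ...   | inj₁ (s≤s v≤) =
          contradiction v≤ (<⇒≱ (≤-reflexive (sym (φ-injective (trans (φ≡φ′ v≤) eq)))))
        ...   | inj₂ refl     = sym eq
        -- Now `C` drops a vertex before it reaches the bag of `C′`, which still holds it, because
        -- both cliques of `suc n` have the same numbers.
        newest≡ | inj₂ after = contradiction
          (φ∈Bag⁻ (2 + n) (convex _ (asc (suc n)) after
            (φ∈Bag (suc n) (dropped∈Clique α (suc n)))
            (∈C′ (sameClique (dropped∈Clique α (suc n)))
                 (∈Clique⇒≤ α (dropped∈previousClique α n)))))
          (dropped∉nextClique α (suc n))

    -- Which copy has the nearer next bag may vary with `n`; `agree-step` is applied with the roles
    -- exchanged accordingly.
    agree : ∀ {α β} (C : Copy α) (C′ : Copy β) → Ascending _≼_ C → Ascending _≼_ C′ →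
            (∀ {v} → v ≤ k → Copy.φ C v ≡ Copy.φ C′ v) →
            ∀ n → Agree C C′ n × α n ≡ β n
    agree {α} {β} C C′ asc asc′ start n = agree-n n , proj₁ (next n (agree-n n))
      where
      open Copy C using (φ; time)
      open Copy C′ using () renaming (φ to φ′; time to time′)

      next : ∀ n → Agree C C′ n → α n ≡ β n × φ (suc n + k) ≡ φ′ (suc n + k)
      next n agreed with total (time (suc n)) (time′ (suc n))
      ... | inj₁ up   = agree-step C C′ asc n agreed up
      ... | inj₂ down
        with αn , newest ← agree-step C′ C asc′ n
                             (sym (proj₁ agreed) , sym ∘ proj₂ agreed) down = sym αn , sym newest

      agree-n : ∀ n → Agree C C′ n
      agree-n zero    = refl , start
      agree-n (suc n) with agreed@(pivots , φ≡φ′) ← agree-n n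
                      with αn≡βn , newest ← next n agreed =
        pivot-suc-cong α β n pivots αn≡βn , λ v≤ → lemma (m≤n⇒m<n∨m≡n v≤)
        where
        lemma : ∀ {v} → v < suc n + k ⊎ v ≡ suc n + k → φ v ≡ φ′ v
        lemma (inj₁ (s≤s v≤)) = φ≡φ′ v≤
        lemma (inj₂ refl)     = newest

-- Coding binary sequences in a universal graph

module _ (em : ∀ {ℓ} → ExcludedMiddle ℓ) (k : ℕ) (2≤k : 2 ≤ k) (U : Graph)
         (D : LineDecomposition ℓ U) where
  open Cliques k 2≤k
  open LineDecomposition D
  open DecompositionOver decomposition
  open Copies k 2≤k Bag
  open IsTotalOrder isTotalOrder using (total)

  Small : Set ℓ
  Small = ∀ t → ∃[ c ] (c ≤ suc k × HasCardinality (Bag t) [ c ])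

  Bag-convex : ∀ a → Convex _≼_ (λ t → a ∈ Bag t)
  Bag-convex a x≼y y≼z ax az = interval _ _ _ x≼y y≼z (ax , az)

  -- A copy that descends along the line ascends in the reversed order, which has the same convex
  -- sets.
  module Up   = Direction _≼_ total Bag-convex
  module Down = Direction (flip _≼_) (flip total)
                  (λ a x≽y y≽z ax az → Bag-convex a y≽z x≽y az ax)

  copy : Small → ∀ α → U Contains graph α → Copy α
  copy small α (H , iso) = record
    { φ           = φ
    ; φ-injective = injective
    ; time        = time
    ; φ∈Bag       = φ∈Bag
    ; ∈Bag⇒φ      = ∈Bag⇒φ
    }
    where
    open Subgraph H using (edge⇒E)
    open IsIsomorphicTo iso renaming (to to φ)
    open Helly _≼_ total

    commonBag : ∀ n i j → ∃[ t ] (φ (member α n i) ∈ Bag t × φ (member α n j) ∈ Bag t)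
    commonBag n i j with member α n i ≟ member α n j
    -- A vertex is not adjacent to itself, so here the covering of vertices has to provide the bag.
    ... | yes eq with t , i∈ ← coversVertices (φ (member α n i)) =
      t , i∈ , subst (λ v → φ v ∈ Bag t) eq i∈
    ... | no i≢j = coversEdges _ _ (edge⇒E (Equivalence.to (edges _ _)
      (i≢j , n , member∈Clique α n i , member∈Clique α n j)))

    cliqueBag : ∀ n → ∃[ t ] (∀ i → φ (member α n i) ∈ Bag t)
    cliqueBag n = helly nonEmpty (λ i t → φ (member α n i) ∈ Bag t)
                    (λ i → Bag-convex _) (commonBag n)

    time : ℕ → L
    time n = proj₁ (cliqueBag n)

    φ∈Bag : ∀ n {v} → v ∈ Clique α n → φ v ∈ Bag (time n)
    φ∈Bag n v∈ with i , refl ← ∈Clique⇒member α n v∈ = proj₂ (cliqueBag n) i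

    ∈Bag⇒φ : ∀ n {a} → a ∈ Bag (time n) → ∃[ v ] (v ∈ Clique α n × φ v ≡ a)
    ∈Bag⇒φ n {a} a∈ with em {P = ∃[ i ] φ (member α n i) ≡ a}
    ... | yes (i , eq) = member α n i , member∈Clique α n i , eq
    -- One more element besides the `suc k` members of the clique makes `2 + k`, too many for a
    -- small bag.
    ... | no a∉ with c , c≤ , cardinality ← small (time n) =
      contradiction (≤-trans (injection⇒≤ cardinality f f-injective f∈Bag) c≤) 1+n≰n
      where
      f : Fin (2 + k) → V U
      f zero    = a
      f (suc i) = φ (member α n i)

      f-injective : Injective _≡_ _≡_ f
      f-injective {zero}  {zero}  eq = refl
      f-injective {zero}  {suc j} eq = contradiction (j , sym eq) a∉
      f-injective {suc i} {zero}  eq = contradiction (i , eq) a∉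
      f-injective {suc i} {suc j} eq = cong suc (member-injective α n (injective eq))

      f∈Bag : ∀ i → f i ∈ Bag (time n)
      f∈Bag zero    = a∈
      f∈Bag (suc i) = proj₂ (cliqueBag n) i

  private
    ι = proj₁ (countable⇒injection U)

    start : ∀ {α} → Copy α → ℕ
    start C = encode (ι ∘ Copy.φ C) (suc k)

    start-injective : ∀ {α β} (C : Copy α) (C′ : Copy β) → start C ≡ start C′ →
                      ∀ {v} → v ≤ k → Copy.φ C v ≡ Copy.φ C′ v
    start-injective C C′ eq v≤k =
      proj₂ (countable⇒injection U)
        (encode-injective (ι ∘ Copy.φ C) (ι ∘ Copy.φ C′) (suc k) eq (s≤s v≤k))

    -- The first component of the pair, 0 or 1, records the direction, so copies with the same code
    -- can be compared by `agree` in one common order.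
    Code : (ℕ → Bool) → ℕ → Set _
    Code α m = Σ (Copy α) λ C →
      (Ascending _≼_ C × m ≡ pair 0 (start C)) ⊎ (Ascending (flip _≼_) C × m ≡ pair 1 (start C))

    unique : ∀ {α β m} → Code α m → Code β m → α ≗ β
    unique (C , inj₁ (asc , refl)) (C′ , inj₁ (asc′ , eq)) n =
      proj₂ (Up.agree C C′ asc asc′
        (start-injective C C′ (proj₂ (pair-injective 0 (start C) 0 (start C′) eq))) n)
    unique (C , inj₂ (asc , refl)) (C′ , inj₂ (asc′ , eq)) n =
      proj₂ (Down.agree C C′ asc asc′
        (start-injective C C′ (proj₂ (pair-injective 1 (start C) 1 (start C′) eq))) n)
    unique (C , inj₁ (_ , refl)) (C′ , inj₂ (_ , eq)) =
      contradiction (proj₁ (pair-injective 0 (start C) 1 (start C′) eq)) λ ()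
    unique (C , inj₂ (_ , refl)) (C′ , inj₁ (_ , eq)) =
      contradiction (proj₁ (pair-injective 1 (start C) 0 (start C′) eq)) λ ()

  ¬small : Universal U (𝒫 k) → ¬ Small
  ¬small universal small with α , avoids ← cantor em Code unique = avoids _ (proj₂ (code α))
    where
    code : ∀ α → ∃ (Code α)
    code α with C ← copy small α (universal (graph α) (graph∈𝒫 em em α))
           with total (Copy.time C 0) (Copy.time C 1)
    ... | inj₁ up   = _ , C , inj₁ (Up.ascending C up , refl)
    ... | inj₂ down = _ , C , inj₂ (Down.ascending C down , refl)

  width≱⇒Small : ∀ {z} → IsWidth decomposition [ z ] → ¬ (+ suc k ℤ.≤ z) → Small
  width≱⇒Small (upper , _) z≱ t with hasCardinality em (Bag t)
  ... | [ c ] , cardinality with [ c-1≤z ] ← upper _ (t , [ c ] , cardinality , refl) =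
    -- A bag with at least `2 + k` elements would force `z` to be at least `suc k`.
    c , ≮⇒≥ (λ 1+k<c → z≱ (ℤ.≤-trans (ℤ.⊖-monoˡ-≤ 1 {2 + k} {c} 1+k<c) c-1≤z)) , cardinality
  -- An infinite bag would put `⊤⁺` below the finite width `z`.
  ... | ⊤⁺ , infinite with () ← upper _ (t , ⊤⁺ , infinite , refl)

theorem6 : (∀ {ℓ : Level} → ExcludedMiddle ℓ) →
    ∀ (ℓ : Level) (k : ℕ) → 2 ≤ k →
    ∀ (U : Graph) → Universal U (𝒫 k) → LineWidthAtLeast ℓ U (suc k)
theorem6 em ℓ k 2≤k U universal with w , lineWidth ← hasLineWidth em ℓ U =
  w , lineWidth , large w (proj₁ lineWidth)
  where
  large : ∀ w → Σ (LineDecomposition ℓ U) (λ D → IsWidth (LineDecomposition.decomposition D) w) →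
          [ + suc k ] ≤⁺ w
  large ⊤⁺    _         = _ ≤⊤⁺
  large [ z ] (D , D-z) with (+ suc k) ℤ.≤? z
  ... | yes z≥ = [ z≥ ]
  ... | no  z≱ = contradiction (width≱⇒Small em k 2≤k U D D-z z≱) (¬small em k 2≤k U D universal)
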